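{- Let $v \ge 240$ be an integer. Then \[ \beta(4,v,4) \le \left\lfloor \frac{4v-10}{3} \right\rfloor, \] and \[ \beta(4,v,4) \ge \begin{cases} \frac{4v-21}{3} & \text{if } v \equiv 0 \pmod 3,\\ \frac{4v-13}{3} & \text{if } v \equiv 1 \pmod 3,\\ \frac{4v-17}{3} & \text{if } v \equiv 2 \pmod 3. \end{cases} \]
   Context: For integers $v \ge k \ge 2$, a $(v,k)$-packing is a pair $(X,\mathcal{B})$ where $X$ is a set of $v$ points and $\mathcal{B}$ is a set of $k$-subsets of $X$ (blocks) such that every pair of distinct points lies in at most one block. A partial parallel class (PPC) is a set of pairwise disjoint blocks; its size is the number of blocks. A PPC of size $\rho$ is maximum if the packing has no PPC of size $\rho+1$. $\beta(\rho,v,k)$ denotes the maximum number of blocks in a $(v,k)$-packing in which the maximum PPC has size $\rho$. -}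

module Defs where

open import Data.Fin using (Fin)
open import Data.Fin.Subset using (Subset; _∈_; _∩_; ∣_∣; Empty)
open import Data.List using (List; length)
open import Data.List.Membership.Propositional using () renaming (_∈_ to _∈ˡ_)
open import Data.List.Relation.Binary.Subset.Propositional using () renaming (_⊆_ to _⊆ˡ_)
open import Data.List.Relation.Unary.All using (All)
open import Data.List.Relation.Unary.AllPairs using (AllPairs)
open import Data.List.Relation.Unary.Unique.Propositional using (Unique)
open import Data.Nat using (ℕ; suc; _≤_)
open import Data.Product using (∃-syntax; _×_)
open import Relation.Binary.PropositionalEquality using (_≡_; _≢_)
open import Relation.Nullary using (¬_)

-- The point set is Fin v.  A finite set of blocks is a duplicate-free list;
-- Subset v is a bit vector, so propositional equality of blocks is set equality.
record Packing (v k : ℕ) : Set where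
  field
    2≤k            : 2 ≤ k
    k≤v            : k ≤ v
    blocks         : List (Subset v)
    blocks-unique  : Unique blocks
    blocks-size    : All (λ B → ∣ B ∣ ≡ k) blocks
    pair-in-≤1     : ∀ {x y : Fin v} → x ≢ y →
                     ∀ {B C} → B ∈ˡ blocks → C ∈ˡ blocks →
                     x ∈ B → y ∈ B → x ∈ C → y ∈ C → B ≡ C

  numBlocks : ℕ
  numBlocks = length blocks

open Packing public

Disjoint : ∀ {v} → Subset v → Subset v → Set
Disjoint B C = Empty (B ∩ C)

-- AllPairs compares entries at different positions only, so together with
-- Unique it says that distinct members of the class are disjoint.
record IsPPC {v k} (D : Packing v k) (P : List (Subset v)) : Set where
  field
    ⊆-blocks          : P ⊆ˡ blocks D
    unique            : Unique P
    pairwise-disjoint : AllPairs Disjoint P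

HasPPCOfSize : ∀ {v k} → Packing v k → ℕ → Set
HasPPCOfSize D ρ = ∃[ P ] IsPPC D P × length P ≡ ρ

MaximumPPCSize : ∀ {v k} → Packing v k → ℕ → Set
MaximumPPCSize D ρ = HasPPCOfSize D ρ × ¬ HasPPCOfSize D (suc ρ)

-- β⟨ ρ , v , k ⟩≡ b  reads "β(ρ,v,k) exists and equals b".  It is a relation
-- because there need not be any packing to maximise over; b is unique.
record β⟨_,_,_⟩≡_ (ρ v k b : ℕ) : Set where
  field
    attained : ∃[ D ] MaximumPPCSize {v} {k} D ρ × numBlocks D ≡ b
    maximal  : ∀ (D : Packing v k) → MaximumPPCSize D ρ → numBlocks D ≤ b

{-# OPTIONS --safe #-}
module Submission where

-- Upper bound.  Let s be the largest number of disjoint blocks, s ≤ 4.  If some point x has degree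
-- at least 17, then any s disjoint blocks missing x cover at most 16 points, so some block through x
-- avoids them; hence deleting x and its blocks lowers s.  Otherwise all degrees are at most 16, and
-- deleting the at most 64 blocks that meet a given block also lowers s.  Either step removes at most
-- (a − 1)/3 blocks, where a is the number of points left, and frees at least one point, so there are
-- at most ((v − 1) + (v − 2) + (v − 3) + (v − 4))/3 blocks.
--
-- Lower bound.  With m = ⌊(v − 4)/3⌋, take three groups ℤ/m and four hubs 0, …, 3.  The hubs form one
-- block; the others consist of a hub j and the points i, i + j, i + 2j of the respective groups.
-- Every block meets the hubs, so no five blocks are disjoint, and there are 4m + 1 blocks.
--
-- The maximum β exists because having a packing with a given number of blocks is decidable by
-- exhaustive search.

open import Data.Bool.Properties using () renaming (_≟_ to _≟ᵇ_)
open import Data.Fin using (Fin; zero; suc; toℕ; join; splitAt; combine; remQuot; inject≤)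
import Data.Fin.Properties as Fin
open import Data.Fin.Subset
  using (Subset; inside; outside; _∈_; _∉_; _⊆_; _∪_; _∩_; _─_; _-_; ⊤; ⁅_⁆; ⋃; ∣_∣; Nonempty)
open import Data.Fin.Subset.Properties
  using (_∈?_; nonempty?; anySubset?; drop-∷-⊆; ⊆⊤; ∉⊥; x∈⁅x⁆; x∈⁅y⁆⇒x≡y; ∣⊥∣≡0; ∣⊤∣≡n;
         x∈p∩q⁺; x∈p∩q⁻; p⊆p∪q; q⊆p∪q; x∈p∪q⁻; ∪-identityˡ;
         p─⊥≡p; p─q⊆p; x∈p∧x∉q⇒x∈p─q; x∈p∧x≢y⇒x∈p-y; x∈p⇒∣p-x∣<∣p∣)
open import Data.List using (List; []; _∷_; length; map; filter; tabulate; allFin)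
import Data.List.Membership.DecPropositional as DecMembership
open import Data.List.Membership.Propositional using (find) renaming (_∈_ to _∈ˡ_)
open import Data.List.Membership.Propositional.Properties
  using (∈-filter⁻; ∈-map⁺; ∈-map⁻; ∈-tabulate⁺; ∈-tabulate⁻; ∈-allFin)
open import Data.List.Properties using (length-map; length-tabulate)
open import Data.List.Relation.Binary.Sublist.Propositional.Properties
  using (filter-⊆; length-mono-≤) renaming (filter⁺ to filter⁺-⊆)
open import Data.List.Relation.Binary.Subset.Propositional using () renaming (_⊆_ to _⊆ˡ_)
open import Data.List.Relation.Unary.All as All using (All; []; _∷_)
import Data.List.Relation.Unary.All.Properties as All
open import Data.List.Relation.Unary.AllPairs using (AllPairs; []; _∷_; allPairs?)
import Data.List.Relation.Unary.AllPairs.Properties as AllPairs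
open import Data.List.Relation.Unary.Any using (here; there)
open import Data.List.Relation.Unary.Unique.Propositional using (Unique)
import Data.List.Relation.Unary.Unique.Propositional.Properties as Unique
open import Data.Nat
  using (ℕ; zero; suc; NonZero; >-nonZero; _+_; _≤_; _<_; _≥_; _*_; _∸_; _/_; _%_; z≤n; s≤s; s≤s⁻¹;
         _≤?_; _≟_)
open import Data.Nat.DivMod
  using (_mod_; _divMod_; result; m*n/n≡m; /-monoˡ-≤; m%n<n; m%n≤n; m%n%n≡m%n; m<n⇒m%n≡m;
         m≡m%n+[m/n]*n; %-distribˡ-+; [m+kn]%n≡m%n)
open import Data.Nat.Properties hiding (_≟_; _≤?_)
open import Data.Nat.Tactic.RingSolver using (solve-∀)
open import Data.Product using (∃-syntax; _×_; _,_; proj₁; proj₂; -,_)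
open import Data.Sum using (_⊎_; inj₁; inj₂)
open import Data.Sum.Properties using (inj₁-injective; inj₂-injective)
open import Data.Vec using ([]; _∷_; here; there)
open import Data.Vec.Properties using () renaming (≡-dec to ≡-decᵛ)
open import Function using (_∘_)
open import Relation.Binary using (DecidableEquality; tri<; tri≈; tri>)
open import Relation.Binary.PropositionalEquality
  using (_≡_; _≢_; refl; sym; trans; cong; cong₂; subst; module ≡-Reasoning)
open import Relation.Nullary using (¬_; Dec; yes; no; ¬?; contradiction)
open import Relation.Nullary.Decidable using (map′; _×-dec_; _→-dec_)
open import Relation.Unary using (Pred; Decidable)
open import Defs

private variable
  n v : ℕ

-- Cardinalities, differences and unions of finite subsets.

x∈p─q⇒x∉q : ∀ (p q : Subset n) {x} → x ∈ p ─ q → x ∉ q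
x∈p─q⇒x∉q (inside  ∷ p) (outside ∷ q) here      ()
x∈p─q⇒x∉q (_ ∷ p)       (_ ∷ q)       (there i) (there j) = x∈p─q⇒x∉q p q i j

∣q∣+∣p─q∣≤∣p∣ : ∀ (p q : Subset n) → q ⊆ p → ∣ q ∣ + ∣ p ─ q ∣ ≤ ∣ p ∣
∣q∣+∣p─q∣≤∣p∣ []            []            q⊆p = z≤n
∣q∣+∣p─q∣≤∣p∣ (inside  ∷ p) (inside  ∷ q) q⊆p = s≤s (∣q∣+∣p─q∣≤∣p∣ p q (drop-∷-⊆ q⊆p))
∣q∣+∣p─q∣≤∣p∣ (inside  ∷ p) (outside ∷ q) q⊆p =
  ≤-trans (≤-reflexive (+-suc ∣ q ∣ _)) (s≤s (∣q∣+∣p─q∣≤∣p∣ p q (drop-∷-⊆ q⊆p)))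
∣q∣+∣p─q∣≤∣p∣ (outside ∷ p) (inside  ∷ q) q⊆p with () ← q⊆p here
∣q∣+∣p─q∣≤∣p∣ (outside ∷ p) (outside ∷ q) q⊆p = ∣q∣+∣p─q∣≤∣p∣ p q (drop-∷-⊆ q⊆p)

∣p∪q∣≤∣p∣+∣q∣ : ∀ (p q : Subset n) → ∣ p ∪ q ∣ ≤ ∣ p ∣ + ∣ q ∣
∣p∪q∣≤∣p∣+∣q∣ []            []            = z≤n
∣p∪q∣≤∣p∣+∣q∣ (inside  ∷ p) (inside  ∷ q) =
  s≤s (≤-trans (∣p∪q∣≤∣p∣+∣q∣ p q) (+-monoʳ-≤ ∣ p ∣ (n≤1+n _)))
∣p∪q∣≤∣p∣+∣q∣ (inside  ∷ p) (outside ∷ q) = s≤s (∣p∪q∣≤∣p∣+∣q∣ p q)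
∣p∪q∣≤∣p∣+∣q∣ (outside ∷ p) (inside  ∷ q) =
  ≤-trans (s≤s (∣p∪q∣≤∣p∣+∣q∣ p q)) (≤-reflexive (sym (+-suc ∣ p ∣ _)))
∣p∪q∣≤∣p∣+∣q∣ (outside ∷ p) (outside ∷ q) = ∣p∪q∣≤∣p∣+∣q∣ p q

x∈p⇒∣p∣≡1+∣p-x∣ : ∀ {p : Subset n} {x} → x ∈ p → ∣ p ∣ ≡ suc ∣ p - x ∣
x∈p⇒∣p∣≡1+∣p-x∣ {p = _ ∷ p}       here      = cong (suc ∘ ∣_∣) (sym (p─⊥≡p p))
x∈p⇒∣p∣≡1+∣p-x∣ {p = inside  ∷ p} (there i) = cong suc (x∈p⇒∣p∣≡1+∣p-x∣ i)
x∈p⇒∣p∣≡1+∣p-x∣ {p = outside ∷ p} (there i) = x∈p⇒∣p∣≡1+∣p-x∣ i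

0<∣p∣⇒nonempty : ∀ {p : Subset n} → 0 < ∣ p ∣ → Nonempty p
0<∣p∣⇒nonempty {p = inside  ∷ p} _   = zero , here
0<∣p∣⇒nonempty {p = outside ∷ p} 0<p with i , i∈p ← 0<∣p∣⇒nonempty 0<p = suc i , there i∈p

x∈p-y⇒x≢y : ∀ {p : Subset n} {x y} → x ∈ p - y → x ≢ y
x∈p-y⇒x≢y {x = x} x∈p-y refl = x∈p─q⇒x∉q _ _ x∈p-y (x∈⁅x⁆ x)

p∈ps⇒p⊆⋃ps : ∀ {p : Subset n} {ps} → p ∈ˡ ps → p ⊆ ⋃ ps
p∈ps⇒p⊆⋃ps (here refl)  = p⊆p∪q _
p∈ps⇒p⊆⋃ps (there p∈ps) = q⊆p∪q _ _ ∘ p∈ps⇒p⊆⋃ps p∈ps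

x∈⋃ps⇒x∈p : ∀ (ps : List (Subset n)) {x} → x ∈ ⋃ ps → ∃[ p ] p ∈ˡ ps × x ∈ p
x∈⋃ps⇒x∈p []       x∈ = contradiction x∈ ∉⊥
x∈⋃ps⇒x∈p (p ∷ ps) x∈ with x∈p∪q⁻ p (⋃ ps) x∈
... | inj₁ x∈p  = p , here refl , x∈p
... | inj₂ x∈ps with q , q∈ps , x∈q ← x∈⋃ps⇒x∈p ps x∈ps = q , there q∈ps , x∈q

∣⋃ps∣≤∣ps∣*k : ∀ {k} {ps : List (Subset n)} → All (λ p → ∣ p ∣ ≡ k) ps → ∣ ⋃ ps ∣ ≤ length ps * k
∣⋃ps∣≤∣ps∣*k {n = n} [] = ≤-reflexive (∣⊥∣≡0 n)
∣⋃ps∣≤∣ps∣*k {ps = p ∷ ps} (refl ∷ sizes) =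
  ≤-trans (∣p∪q∣≤∣p∣+∣q∣ p (⋃ ps)) (+-monoʳ-≤ ∣ p ∣ (∣⋃ps∣≤∣ps∣*k sizes))

length-disjoint : ∀ {k} {A : Subset v} {ps} → All (λ p → ∣ p ∣ ≡ k) ps → All (_⊆ A) ps →
                  AllPairs Disjoint ps → length ps * k ≤ ∣ A ∣
length-disjoint []             []           []             = z≤n
length-disjoint {A = A} {ps = p ∷ ps} (refl ∷ sizes) (p⊆A ∷ ⊆A) (p∥ps ∷ disj) =
  ≤-trans (+-monoʳ-≤ ∣ p ∣ (length-disjoint sizes (All.zipWith
      (λ {q} (q⊆A , p∥q) {x} x∈q →
        x∈p∧x∉q⇒x∈p─q (q⊆A x∈q) (λ x∈p → p∥q (x , x∈p∩q⁺ (x∈p , x∈q))))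
      (⊆A , p∥ps)) disj))
    (∣q∣+∣p─q∣≤∣p∣ A p p⊆A)

-- A repeated nonempty set would meet itself. Nonemptiness matters, as the empty set is disjoint
-- from itself.
disjoint⇒unique : ∀ {ps : List (Subset v)} → All Nonempty ps → AllPairs Disjoint ps → Unique ps
disjoint⇒unique []                       []            = []
disjoint⇒unique (_∷_ {p} (x , x∈p) ne) (p∥ps ∷ disj) =
  All.map (λ p∥q p≡q → p∥q (x , x∈p∩q⁺ (x∈p , subst (x ∈_) p≡q x∈p))) p∥ps ∷
  disjoint⇒unique ne disj

-- Counting and comparing entries of lists.

module _ {a} {A : Set a} where

  length-filter-split : ∀ {p} {P : Pred A p} (P? : Decidable P) xs →
                        length xs ≡ length (filter P? xs) + length (filter (¬? ∘ P?) xs)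
  length-filter-split P? [] = refl
  length-filter-split P? (x ∷ xs) with P? x
  ... | yes _ = cong suc (length-filter-split P? xs)
  ... | no  _ = trans (cong suc (length-filter-split P? xs)) (sym (+-suc _ _))

  allPairs⁺ : ∀ {r} {R : A → A → Set r} {xs} → Unique xs →
              (∀ {x y} → x ∈ˡ xs → y ∈ˡ xs → x ≢ y → R x y) → AllPairs R xs
  allPairs⁺ []            f = []
  allPairs⁺ (x≢xs ∷ uniq) f =
    All.tabulate (λ y∈xs → f (here refl) (there y∈xs) (All.lookup x≢xs y∈xs)) ∷
    allPairs⁺ uniq (λ x∈xs y∈xs → f (there x∈xs) (there y∈xs))

  length≤1 : ∀ {xs : List A} → Unique xs → (∀ {x y} → x ∈ˡ xs → y ∈ˡ xs → x ≡ y) → length xs ≤ 1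
  length≤1 []                  _   = z≤n
  length≤1 ([] ∷ _)            _   = ≤-refl
  length≤1 ((x≢y ∷ _) ∷ _) all-equal = contradiction (all-equal (here refl) (there (here refl))) x≢y

-- Degrees of points and families that hit a given set.

degree : Fin v → List (Subset v) → ℕ
degree x = length ∘ filter (x ∈?_)

0<degree⇒∈ : ∀ {x : Fin v} 𝓑 → 0 < degree x 𝓑 → ∃[ B ] B ∈ˡ 𝓑 × x ∈ B
0<degree⇒∈ {x = x} 𝓑 0<d with filter (x ∈?_) 𝓑 in eq
... | B ∷ _ = B , ∈-filter⁻ (x ∈?_) (subst (B ∈ˡ_) (sym eq) (here refl))

degree-filter : ∀ {p} {P : Pred (Subset v) p} (P? : Decidable P) x 𝓑 →
                degree x (filter P? 𝓑) ≤ degree x 𝓑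
degree-filter P? x 𝓑 = length-mono-≤ (filter⁺-⊆ (x ∈?_) (x ∈?_) (λ { refl x∈B → x∈B }) (filter-⊆ P? 𝓑))

-- Delete the points of `S` one by one: at most `d` sets contain the chosen point, and the others
-- still hit what remains of `S`. It serves with `d` = 16 when all degrees are small, and with `d` =
-- 1 when no two members of the family share a point of `S`.
length-hitting : ∀ d (S : Subset v) 𝓑 → All (λ B → Nonempty (B ∩ S)) 𝓑 →
                 (∀ {x} → x ∈ S → degree x 𝓑 ≤ d) → length 𝓑 ≤ ∣ S ∣ * d
length-hitting {v} d S 𝓑 = go ∣ S ∣ S 𝓑 ≤-refl
  where
  -- The recursion runs on the bound `n` for `∣ S ∣`, since `S - x` is not structurally smaller than
  -- `S`.
  go : ∀ n (S : Subset v) 𝓑 → ∣ S ∣ ≤ n → All (λ B → Nonempty (B ∩ S)) 𝓑 →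
       (∀ {x} → x ∈ S → degree x 𝓑 ≤ d) → length 𝓑 ≤ n * d
  go n S 𝓑 ∣S∣≤n hit deg with nonempty? S
  go n S []      ∣S∣≤n hit                deg | no S-empty = z≤n
  go n S (B ∷ 𝓑) ∣S∣≤n ((x , x∈B∩S) ∷ _) deg | no S-empty =
    contradiction (x , proj₂ (x∈p∩q⁻ B S x∈B∩S)) S-empty
  go zero    S 𝓑 ∣S∣≤0 hit deg | yes (x , x∈S) =
    contradiction (≤-trans (≤-reflexive (sym (x∈p⇒∣p∣≡1+∣p-x∣ x∈S))) ∣S∣≤0) λ ()
  go (suc n) S 𝓑 ∣S∣≤n hit deg | yes (x , x∈S) = begin
    length 𝓑                          ≡⟨ length-filter-split (x ∈?_) 𝓑 ⟩
    degree x 𝓑 + length 𝓑′            ≤⟨ +-mono-≤ (deg x∈S) (go n (S - x) 𝓑′ ∣S-x∣≤n hit′ deg′) ⟩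
    d + n * d                         ∎
    where
    open ≤-Reasoning
    𝓑′ : List (Subset v)
    𝓑′ = filter (¬? ∘ (x ∈?_)) 𝓑
    ∣S-x∣≤n : ∣ S - x ∣ ≤ n
    ∣S-x∣≤n = s≤s⁻¹ (≤-trans (x∈p⇒∣p-x∣<∣p∣ x∈S) ∣S∣≤n)
    hit′ : All (λ B → Nonempty (B ∩ (S - x))) 𝓑′
    hit′ = All.tabulate λ {B} B∈𝓑′ →
      let B∈𝓑 , x∉B = ∈-filter⁻ (¬? ∘ (x ∈?_)) B∈𝓑′
          y , y∈B∩S = All.lookup hit B∈𝓑
          y∈B , y∈S = x∈p∩q⁻ B S y∈B∩S
      in y , x∈p∩q⁺ (y∈B , x∈p∧x≢y⇒x∈p-y y∈S λ y≡x → x∉B (subst (_∈ B) y≡x y∈B))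
    deg′ : ∀ {y} → y ∈ S - x → degree y 𝓑′ ≤ d
    deg′ {y} y∈S-x = ≤-trans (degree-filter (¬? ∘ (x ∈?_)) y 𝓑) (deg (p─q⊆p S _ y∈S-x))

-- The upper bound: peeling off points and blocks.

-- The surviving points are a subset `A` of the fixed `Fin v`, so deleting a point requires no
-- renumbering of the blocks.
record LinearSystem (𝓑 : List (Subset v)) (A : Subset v) : Set where
  field
    uniq   : Unique 𝓑
    size   : ∀ {B} → B ∈ˡ 𝓑 → ∣ B ∣ ≡ 4
    linear : ∀ {x y} → x ≢ y → ∀ {B C} → B ∈ˡ 𝓑 → C ∈ˡ 𝓑 →
             x ∈ B → y ∈ B → x ∈ C → y ∈ C → B ≡ C
    within : ∀ {B} → B ∈ˡ 𝓑 → B ⊆ A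

-- `Unique` is left out in contrast to `IsPPC`; for blocks of size 4 it follows from disjointness by
-- `disjoint⇒unique`.
NoDisjoint : ℕ → List (Subset v) → Set
NoDisjoint s 𝓑 = ∀ P → P ⊆ˡ 𝓑 → AllPairs Disjoint P → length P ≢ s

linearSystem-filter : ∀ {p} {P : Pred (Subset v) p} (P? : Decidable P) {𝓑 A} →
                      LinearSystem 𝓑 A → LinearSystem (filter P? 𝓑) A
linearSystem-filter P? sys = record
  { uniq   = Unique.filter⁺ P? uniq
  ; size   = size ∘ proj₁ ∘ ∈-filter⁻ P?
  ; linear = λ x≢y B∈ C∈ → linear x≢y (proj₁ (∈-filter⁻ P? B∈)) (proj₁ (∈-filter⁻ P? C∈))
  ; within = within ∘ proj₁ ∘ ∈-filter⁻ P?
  }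
  where open LinearSystem sys

∈⇒nonempty : ∀ {𝓑} {A B : Subset v} → LinearSystem 𝓑 A → B ∈ˡ 𝓑 → Nonempty B
∈⇒nonempty sys B∈𝓑 =
  0<∣p∣⇒nonempty (subst (0 <_) (sym (LinearSystem.size sys B∈𝓑)) (s≤s z≤n))

-- By linearity the blocks through `x` become pairwise disjoint triples once `x` is removed, and
-- these all fit into `A - x`. The point `x` itself makes the inequality strict, which is where the
-- summand a - 1 of the final bound comes from.
degree*3<∣A∣ : ∀ {𝓑} {A : Subset v} {x} → LinearSystem 𝓑 A → x ∈ A → degree x 𝓑 * 3 < ∣ A ∣
degree*3<∣A∣ {v} {𝓑} {A} {x} sys x∈A = begin-strict
  degree x 𝓑 * 3                        ≡⟨ cong (_* 3) (length-map (_- x) star) ⟨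
  length (map (_- x) star) * 3          ≤⟨ length-disjoint sizes insides disjoints ⟩
  ∣ A - x ∣                             <⟨ x∈p⇒∣p-x∣<∣p∣ x∈A ⟩
  ∣ A ∣                                 ∎
  where
  open ≤-Reasoning
  star : List (Subset v)
  star = filter (x ∈?_) 𝓑
  open LinearSystem (linearSystem-filter (x ∈?_) sys)
  x∈ : ∀ {B} → B ∈ˡ star → x ∈ B
  x∈ = proj₂ ∘ ∈-filter⁻ (x ∈?_) {xs = 𝓑}
  sizes : All (λ p → ∣ p ∣ ≡ 3) (map (_- x) star)
  sizes = All.map⁺ (All.tabulate λ B∈ →
    suc-injective (trans (sym (x∈p⇒∣p∣≡1+∣p-x∣ (x∈ B∈))) (size B∈)))
  insides : All (_⊆ (A - x)) (map (_- x) star)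
  insides = All.map⁺ (All.tabulate λ {B} B∈ y∈B-x →
    x∈p∧x≢y⇒x∈p-y (within B∈ (p─q⊆p B _ y∈B-x)) (x∈p-y⇒x≢y y∈B-x))
  disjoints : AllPairs Disjoint (map (_- x) star)
  disjoints = AllPairs.map⁺ (allPairs⁺ uniq λ {B} {C} B∈ C∈ B≢C (y , y∈∩) →
    let y∈B-x , y∈C-x = x∈p∩q⁻ (B - x) (C - x) y∈∩
    in B≢C (linear (x∈p-y⇒x≢y y∈B-x) B∈ C∈
              (p─q⊆p B _ y∈B-x) (x∈ B∈) (p─q⊆p C _ y∈C-x) (x∈ C∈)))

-- If every block through `x` met the union of `P`, then each would use up a point of it: such a
-- point differs from `x`, because `P` misses `x`, and so lies on at most one block through `x`. The
-- degree of `x` would then be at most `s * 4`.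
heavy-point-extends : ∀ {s} {𝓑} {A : Subset v} {x} {P} → LinearSystem 𝓑 A → s * 4 < degree x 𝓑 →
                      P ⊆ˡ filter (¬? ∘ (x ∈?_)) 𝓑 → length P ≤ s →
                      ∃[ B ] B ∈ˡ 𝓑 × All (Disjoint B) P
heavy-point-extends {v} {s} {𝓑} {A} {x} {P} sys heavy P⊆ ∣P∣≤s
  with All.all? (λ B → nonempty? (B ∩ ⋃ P)) (filter (x ∈?_) 𝓑)
... | yes hit = contradiction heavy (≤⇒≯ (begin
  length star       ≤⟨ length-hitting 1 (⋃ P) star hit deg ⟩
  ∣ ⋃ P ∣ * 1       ≡⟨ *-identityʳ _ ⟩
  ∣ ⋃ P ∣           ≤⟨ ∣⋃ps∣≤∣ps∣*k (All.tabulate (size ∘ proj₁ ∘ ∈-filter⁻ (¬? ∘ (x ∈?_)) ∘ P⊆)) ⟩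
  length P * 4      ≤⟨ *-monoˡ-≤ 4 ∣P∣≤s ⟩
  s * 4             ∎))
  where
  open ≤-Reasoning
  open LinearSystem sys
  star : List (Subset v)
  star = filter (x ∈?_) 𝓑
  deg : ∀ {y} → y ∈ ⋃ P → degree y star ≤ 1
  deg {y} y∈⋃P with C , C∈P , y∈C ← x∈⋃ps⇒x∈p P y∈⋃P =
    length≤1 (Unique.filter⁺ (y ∈?_) (Unique.filter⁺ (x ∈?_) uniq)) λ B∈ B′∈ →
      let B∈star  , y∈B  = ∈-filter⁻ (y ∈?_) {xs = star} B∈
          B′∈star , y∈B′ = ∈-filter⁻ (y ∈?_) {xs = star} B′∈
          B∈𝓑  , x∈B  = ∈-filter⁻ (x ∈?_) {xs = 𝓑} B∈star
          B′∈𝓑 , x∈B′ = ∈-filter⁻ (x ∈?_) {xs = 𝓑} B′∈star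
          x∉C = proj₂ (∈-filter⁻ (¬? ∘ (x ∈?_)) {xs = 𝓑} (P⊆ C∈P))
      in linear (λ x≡y → x∉C (subst (_∈ C) (sym x≡y) y∈C)) B∈𝓑 B′∈𝓑 x∈B y∈B x∈B′ y∈B′
... | no ¬hit with B , B∈star , B∩⋃P-empty ← find (All.¬All⇒Any¬ (λ B → nonempty? (B ∩ ⋃ P)) _ ¬hit) =
  B , proj₁ (∈-filter⁻ (x ∈?_) B∈star) ,
  All.tabulate λ {C} C∈P (y , y∈B∩C) →
    let y∈B , y∈C = x∈p∩q⁻ B C y∈B∩C
    in B∩⋃P-empty (y , x∈p∩q⁺ (y∈B , p∈ps⇒p⊆⋃ps C∈P y∈C))

-- bound s a = (a − 1) + (a − 2) + ⋯ + (a − s)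
bound : ℕ → ℕ → ℕ
bound zero    a       = 0
bound (suc s) zero    = 0
bound (suc s) (suc a) = a + bound s a

-- The step shared by the heavy and the light case, with `Q` selecting the blocks to delete. All
-- blocks through `x` are among them, so the rest lives on `A - x`. If `s` blocks of the rest were
-- disjoint, `extend` would add one more from `𝓑`, against `NoDisjoint (suc s) 𝓑`. The induction
-- hypothesis enters as the last argument.
length-peel : ∀ {s a n q} {𝓑} {A : Subset v} {Q : Pred (Subset v) q} (Q? : Decidable Q) {x} →
  LinearSystem 𝓑 A → NoDisjoint (suc s) 𝓑 → ∣ A ∣ ≡ suc a → x ∈ A →
  (∀ {B} → B ∈ˡ 𝓑 → x ∈ B → Q B) →
  length (filter Q? 𝓑) * 3 ≤ a →
  (∀ {P} → P ⊆ˡ filter (¬? ∘ Q?) 𝓑 → length P ≡ s → ∃[ B ] B ∈ˡ 𝓑 × All (Disjoint B) P) →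
  (∀ {𝓒} {A′ : Subset v} → ∣ A′ ∣ ≡ a → LinearSystem 𝓒 A′ → NoDisjoint s 𝓒 → length 𝓒 * 3 ≤ n) →
  length 𝓑 * 3 ≤ a + n
length-peel {v} {s} {a} {n} {𝓑 = 𝓑} {A} Q? {x} sys free ∣A∣≡ x∈A x∈⇒Q few extend ih = begin
  length 𝓑 * 3                                   ≡⟨ cong (_* 3) (length-filter-split Q? 𝓑) ⟩
  (length (filter Q? 𝓑) + length rest) * 3       ≡⟨ *-distribʳ-+ 3 (length (filter Q? 𝓑)) _ ⟩
  length (filter Q? 𝓑) * 3 + length rest * 3     ≤⟨ +-mono-≤ few (ih ∣A-x∣≡a rest-sys rest-free) ⟩
  a + n                                          ∎
  where
  open ≤-Reasoning
  rest : List (Subset v)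
  rest = filter (¬? ∘ Q?) 𝓑
  open LinearSystem (linearSystem-filter (¬? ∘ Q?) sys)
  rest-sys : LinearSystem rest (A - x)
  rest-sys = record
    { uniq   = uniq
    ; size   = size
    ; linear = linear
    ; within = λ {B} B∈rest y∈B →
        let B∈𝓑 , ¬QB = ∈-filter⁻ (¬? ∘ Q?) B∈rest
        in x∈p∧x≢y⇒x∈p-y (within B∈rest y∈B) λ y≡x → ¬QB (x∈⇒Q B∈𝓑 (subst (_∈ B) y≡x y∈B))
    }
  ∣A-x∣≡a : ∣ A - x ∣ ≡ a
  ∣A-x∣≡a = suc-injective (trans (sym (x∈p⇒∣p∣≡1+∣p-x∣ x∈A)) ∣A∣≡)
  rest-free : NoDisjoint s rest
  rest-free P P⊆rest disj ∣P∣≡ with B , B∈𝓑 , B∥P ← extend P⊆rest ∣P∣≡ =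
    free (B ∷ P) (λ { (here refl) → B∈𝓑
                    ; (there C∈P) → proj₁ (∈-filter⁻ (¬? ∘ Q?) (P⊆rest C∈P)) })
         (B∥P ∷ disj) (cong suc ∣P∣≡)

-- The size condition bounds `a ∸ s` because `s` and `a` fall together in the recursion: it stays
-- literally the same at every level.
length-linearSystem : ∀ s a {𝓑} {A : Subset v} → s ≤ 4 → 193 ≤ a ∸ s → ∣ A ∣ ≡ a →
                      LinearSystem 𝓑 A → NoDisjoint (suc s) 𝓑 → length 𝓑 * 3 ≤ bound s a
length-linearSystem s a {[]} _ _ _ _ _ = z≤n
length-linearSystem zero a {B ∷ 𝓑} _ _ _ _ free =
  contradiction refl (free (B ∷ []) (λ { (here eq) → here eq }) ([] ∷ []))
length-linearSystem {v} (suc s) (suc a) {𝓑@(B ∷ _)} {A} s<4 large ∣A∣≡1+a sys free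
  with Fin.any? (λ x → 17 ≤? degree x 𝓑)
... | yes (x , heavy) =
  length-peel (x ∈?_) sys free ∣A∣≡1+a x∈A (λ _ x∈B → x∈B)
    (s≤s⁻¹ (subst (degree x 𝓑 * 3 <_) ∣A∣≡1+a (degree*3<∣A∣ sys x∈A)))
    -- The threshold 17 exceeds 4 · 4 and works at every level, since `P` never has more than four
    -- members.
    (λ P⊆ ∣P∣≡ → heavy-point-extends {x = x} sys heavy P⊆ (≤-trans (≤-reflexive ∣P∣≡) s<4))
    (length-linearSystem s a (<⇒≤ s<4) large)
  where
  open LinearSystem sys
  x∈A : x ∈ A
  x∈A with C , C∈𝓑 , x∈C ← 0<degree⇒∈ 𝓑 (≤-trans (s≤s z≤n) heavy) = within C∈𝓑 x∈C
-- Any point of `B` may be freed: all blocks through it meet `B` and are deleted.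
... | no light with x , x∈B ← ∈⇒nonempty sys (here refl) =
  length-peel meets? sys free ∣A∣≡1+a (within (here refl) x∈B)
    (λ _ x∈C → x , x∈p∩q⁺ (x∈C , x∈B))
    -- The at most 64 deleted blocks cost 64 · 3 = 192, which is below 193 ≤ a ∸ s ≤ a.
    (≤-trans (*-monoˡ-≤ 3 meets≤64) (≤-trans (n≤1+n 192) (≤-trans large (m∸n≤m a s))))
    (λ P⊆ _ → B , here refl , All.tabulate λ {C} C∈P (y , y∈B∩C) →
      let y∈B , y∈C = x∈p∩q⁻ B C y∈B∩C
      in proj₂ (∈-filter⁻ (¬? ∘ meets?) {xs = 𝓑} (P⊆ C∈P)) (y , x∈p∩q⁺ (y∈C , y∈B)))
    (length-linearSystem s a (<⇒≤ s<4) large)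
  where
  open LinearSystem sys
  meets? : Decidable (λ C → Nonempty (C ∩ B))
  meets? C = nonempty? (C ∩ B)
  meets≤64 : length (filter meets? 𝓑) ≤ 64
  meets≤64 = ≤-trans
    (length-hitting 16 B (filter meets? 𝓑)
      (All.tabulate (proj₂ ∘ ∈-filter⁻ meets? {xs = 𝓑}))
      (λ {y} _ → ≤-trans (degree-filter meets? y 𝓑) (s≤s⁻¹ (≰⇒> λ heavy → light (y , heavy)))))
    (*-monoˡ-≤ 16 (≤-reflexive (size (here refl))))

bound-4 : ∀ v → 4 ≤ v → bound 4 v ≡ 4 * v ∸ 10
-- With v = w + 4 both sides become 4w + 6, so the truncated subtraction is exact.
bound-4 _ (s≤s (s≤s (s≤s (s≤s {n = w} z≤n)))) =
  trans (identity w) (sym (trans (cong (_∸ 10) (identity′ w)) (m+n∸n≡m _ 10)))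
  where
  identity : ∀ w → suc (suc (suc w)) + (suc (suc w) + (suc w + (w + 0))) ≡ 4 * w + 6
  identity = solve-∀
  identity′ : ∀ w → 4 * suc (suc (suc (suc w))) ≡ 4 * w + 6 + 10
  identity′ = solve-∀

numBlocks-upper : v ≥ 240 → (D : Packing v 4) → MaximumPPCSize D 4 → numBlocks D ≤ (4 * v ∸ 10) / 3
numBlocks-upper {v} v≥240 D (_ , no-5) = begin
  numBlocks D               ≡⟨ m*n/n≡m (numBlocks D) 3 ⟨
  numBlocks D * 3 / 3       ≤⟨ /-monoˡ-≤ 3 (length-linearSystem 4 v ≤-refl
                                 (≤-trans (m≤m+n 193 43) (∸-monoˡ-≤ 4 v≥240)) (∣⊤∣≡n v) sys free) ⟩
  bound 4 v / 3             ≡⟨ cong (_/ 3) (bound-4 v (≤-trans (m≤m+n 4 236) v≥240)) ⟩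
  (4 * v ∸ 10) / 3          ∎
  where
  open ≤-Reasoning
  sys : LinearSystem (blocks D) ⊤
  sys = record { uniq = blocks-unique D ; size = All.lookup (blocks-size D)
               ; linear = pair-in-≤1 D ; within = λ _ → ⊆⊤ }
  free : NoDisjoint 5 (blocks D)
  free P P⊆ disj ∣P∣≡5 = no-5 (P , record
    { ⊆-blocks = P⊆ ; unique = disjoint⇒unique (All.tabulate (∈⇒nonempty sys ∘ P⊆)) disj
    ; pairwise-disjoint = disj } , ∣P∣≡5)

-- Subsets given by lists of points.

fromList : List (Fin n) → Subset n
fromList = ⋃ ∘ map ⁅_⁆

∈-fromList⁺ : ∀ {x : Fin n} {xs} → x ∈ˡ xs → x ∈ fromList xs
∈-fromList⁺ (here refl) = p⊆p∪q _ (x∈⁅x⁆ _)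
∈-fromList⁺ (there x∈)  = q⊆p∪q _ _ (∈-fromList⁺ x∈)

∈-fromList⁻ : ∀ {x : Fin n} xs → x ∈ fromList xs → x ∈ˡ xs
∈-fromList⁻ []       x∈ = contradiction x∈ ∉⊥
∈-fromList⁻ (y ∷ ys) x∈ with x∈p∪q⁻ ⁅ y ⁆ _ x∈
... | inj₁ x∈y = here (x∈⁅y⁆⇒x≡y y x∈y)
... | inj₂ x∈p = there (∈-fromList⁻ ys x∈p)

x∉p⇒∣⁅x⁆∪p∣≡1+∣p∣ : ∀ {p : Subset n} {x} → x ∉ p → ∣ ⁅ x ⁆ ∪ p ∣ ≡ suc ∣ p ∣
x∉p⇒∣⁅x⁆∪p∣≡1+∣p∣ {p = inside  ∷ p} {zero} x∉p = contradiction here x∉p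
x∉p⇒∣⁅x⁆∪p∣≡1+∣p∣ {p = outside ∷ p} {zero} x∉p = cong (suc ∘ ∣_∣) (∪-identityˡ p)
x∉p⇒∣⁅x⁆∪p∣≡1+∣p∣ {p = inside  ∷ p} {suc x} x∉p = cong suc (x∉p⇒∣⁅x⁆∪p∣≡1+∣p∣ (x∉p ∘ there))
x∉p⇒∣⁅x⁆∪p∣≡1+∣p∣ {p = outside ∷ p} {suc x} x∉p = x∉p⇒∣⁅x⁆∪p∣≡1+∣p∣ (x∉p ∘ there)

∣fromList∣ : ∀ {xs : List (Fin n)} → Unique xs → ∣ fromList xs ∣ ≡ length xs
∣fromList∣ {n} []                  = ∣⊥∣≡0 n
∣fromList∣ {xs = x ∷ xs} (x≢ ∷ uniq) =
  trans (x∉p⇒∣⁅x⁆∪p∣≡1+∣p∣ (λ x∈ → All.lookup x≢ (∈-fromList⁻ xs x∈) refl))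
        (cong suc (∣fromList∣ uniq))

-- Cancellation modulo m.

module _ (m : ℕ) .{{_ : NonZero m}} where

  -- The number `m ∸ a % m` is an additive inverse of `a` modulo `m` and depends only on the residue
  -- of `a`; adding it to both sums leaves `b` and `b′`.
  %-cancelˡ-+ : ∀ a a′ b b′ → a % m ≡ a′ % m → (a + b) % m ≡ (a′ + b′) % m → b % m ≡ b′ % m
  %-cancelˡ-+ a a′ b b′ a≡a′ a+b≡a′+b′ = begin
    b % m                              ≡⟨ shift a b ⟨
    ((a + b) % m + (m ∸ a % m)) % m    ≡⟨ cong₂ (λ x y → (x + (m ∸ y)) % m) a+b≡a′+b′ a≡a′ ⟩
    ((a′ + b′) % m + (m ∸ a′ % m)) % m ≡⟨ shift a′ b′ ⟩
    b′ % m                             ∎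
    where
    open ≡-Reasoning
    rearrange : ∀ r q b c → (r + q) + b + c ≡ b + ((r + c) + q)
    rearrange = solve-∀
    shift : ∀ a b → ((a + b) % m + (m ∸ a % m)) % m ≡ b % m
    shift a b = begin
      ((a + b) % m + c) % m                   ≡⟨ %-distribˡ-+ ((a + b) % m) c m ⟩
      ((a + b) % m % m + c % m) % m           ≡⟨ cong (λ x → (x + c % m) % m) (m%n%n≡m%n (a + b) m) ⟩
      ((a + b) % m + c % m) % m               ≡⟨ %-distribˡ-+ (a + b) c m ⟨
      (a + b + c) % m                         ≡⟨ cong (λ x → (x + b + c) % m) (m≡m%n+[m/n]*n a m) ⟩
      (a % m + a / m * m + b + c) % m         ≡⟨ cong (_% m) (rearrange (a % m) (a / m * m) b c) ⟩
      (b + (a % m + c + a / m * m)) % m       ≡⟨ cong (λ x → (b + (x + a / m * m)) % m) (m+[n∸m]≡n (m%n≤n a m)) ⟩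
      (b + suc (a / m) * m) % m               ≡⟨ [m+kn]%n≡m%n b (suc (a / m)) m ⟩
      b % m                                   ∎
      where
      c : ℕ
      c = m ∸ a % m

  %-injective : ∀ {a b} → a < m → b < m → a % m ≡ b % m → a ≡ b
  %-injective a<m b<m eq = trans (sym (m<n⇒m%n≡m a<m)) (trans eq (m<n⇒m%n≡m b<m))

  toℕ-%-injective : ∀ {i j : Fin m} → toℕ i % m ≡ toℕ j % m → i ≡ j
  toℕ-%-injective = Fin.toℕ-injective ∘ %-injective (Fin.toℕ<n _) (Fin.toℕ<n _)

-- The lower bound: blocks through four hubs and three groups.

module Construction (m v : ℕ) (10≤m : 10 ≤ m) (fits : 4 + 3 * m ≤ v) where

  instance
    m-nonZero : NonZero m
    m-nonZero = >-nonZero (≤-trans (s≤s z≤n) 10≤m)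

  -- inj₁ j is a hub and inj₂ (g , c) is the point c of group g; the index (i , j) stands for the
  -- block formed by the hub j and the points (i + g j) mod m of the groups g.
  Index Point : Set
  Index = Fin m × Fin 4
  Point = Fin 4 ⊎ (Fin 3 × Fin m)

  -- Hubs come first, then the three groups. The points of `Fin v` from 4 + 3m onwards lie on no
  -- block.
  encode : Point → Fin v
  encode (inj₁ j)       = inject≤ (join 4 (3 * m) (inj₁ j)) fits
  encode (inj₂ (g , c)) = inject≤ (join 4 (3 * m) (inj₂ (combine g c))) fits

  encode-injective : ∀ x y → encode x ≡ encode y → x ≡ y
  encode-injective x y eq = flatten-injective x y
    (trans (sym (Fin.splitAt-join 4 _ (flatten x)))
      (trans (cong (splitAt 4) (Fin.inject≤-injective fits fits _ _
               (trans (sym (encode≡ x)) (trans eq (encode≡ y)))))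
        (Fin.splitAt-join 4 _ (flatten y))))
    where
    flatten : Point → Fin 4 ⊎ Fin (3 * m)
    flatten (inj₁ j)       = inj₁ j
    flatten (inj₂ (g , c)) = inj₂ (combine g c)
    encode≡ : ∀ x → encode x ≡ inject≤ (join 4 (3 * m) (flatten x)) fits
    encode≡ (inj₁ _) = refl
    encode≡ (inj₂ _) = refl
    flatten-injective : ∀ x y → flatten x ≡ flatten y → x ≡ y
    flatten-injective (inj₁ j) (inj₁ k) eq = cong inj₁ (inj₁-injective eq)
    flatten-injective (inj₂ (g , c)) (inj₂ (h , d)) eq
      with refl , refl ← Fin.combine-injective g c h d (inj₂-injective eq) = refl

  coord : Fin 3 → Index → Fin m
  coord g (i , j) = (toℕ i + toℕ g * toℕ j) mod m

  coord≡⇒%≡ : ∀ g {i j i′ j′} → coord g (i , j) ≡ coord g (i′ , j′) →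
              (toℕ i + toℕ g * toℕ j) % m ≡ (toℕ i′ + toℕ g * toℕ j′) % m
  coord≡⇒%≡ g {i} {j} {i′} {j′} eq =
    trans (sym (Fin.toℕ-fromℕ< (m%n<n (toℕ i + toℕ g * toℕ j) m)))
      (trans (cong toℕ eq) (Fin.toℕ-fromℕ< (m%n<n (toℕ i′ + toℕ g * toℕ j′) m)))

  -- For a fixed hub `j`, the coordinate in group `g` is a translation of ℤ/m applied to `i`.
  coord-hub-injective : ∀ g {i i′ j} → coord g (i , j) ≡ coord g (i′ , j) → i ≡ i′
  coord-hub-injective g {i} {i′} {j} eq = toℕ-%-injective m
    (%-cancelˡ-+ m gj gj (toℕ i) (toℕ i′) refl
      (trans (cong (_% m) (+-comm gj (toℕ i)))
        (trans (coord≡⇒%≡ g eq) (cong (_% m) (+-comm (toℕ i′) gj)))))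
    where
    gj : ℕ
    gj = toℕ g * toℕ j

  -- Subtracting the coordinates leaves (h - g) j ≡ (h - g) j′ modulo `m`. Both products are smaller
  -- than `m`, so they are equal as numbers and j = j′; then i = i′ follows as for a hub. Taking g <
  -- h makes the truncated difference the true one.
  coord-coord-injective : ∀ {g h b b′} → toℕ g < toℕ h →
                          coord g b ≡ coord g b′ → coord h b ≡ coord h b′ → b ≡ b′
  coord-coord-injective {g} {h} {i , j} {i′ , j′} g<h eq-g eq-h = conclude j≡j′
    where
    d : ℕ
    d = toℕ h ∸ toℕ g
    instance
      d-nonZero : NonZero d
      d-nonZero = >-nonZero (m<n⇒0<n∸m g<h)
    -- Here d ≤ 2 and j ≤ 3, so the product is at most 6.
    dj<m : ∀ (j : Fin 4) → d * toℕ j < m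
    dj<m j = ≤-trans (s≤s (*-mono-≤ (≤-trans (m∸n≤m (toℕ h) (toℕ g)) (s≤s⁻¹ (Fin.toℕ<n h)))
                                    (s≤s⁻¹ (Fin.toℕ<n j))))
                     (≤-trans (m≤m+n 7 3) 10≤m)
    split : ∀ (i : Fin m) (j : Fin 4) → toℕ i + toℕ h * toℕ j ≡ (toℕ i + toℕ g * toℕ j) + d * toℕ j
    split i j = begin
      toℕ i + toℕ h * toℕ j                 ≡⟨ cong (λ x → toℕ i + x * toℕ j) (m+[n∸m]≡n (<⇒≤ g<h)) ⟨
      toℕ i + (toℕ g + d) * toℕ j           ≡⟨ cong (toℕ i +_) (*-distribʳ-+ (toℕ j) (toℕ g) d) ⟩
      toℕ i + (toℕ g * toℕ j + d * toℕ j)   ≡⟨ +-assoc (toℕ i) _ _ ⟨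
      toℕ i + toℕ g * toℕ j + d * toℕ j     ∎
      where open ≡-Reasoning
    j≡j′ : j ≡ j′
    j≡j′ = Fin.toℕ-injective (*-cancelˡ-≡ (toℕ j) (toℕ j′) d (%-injective m (dj<m j) (dj<m j′)
      (%-cancelˡ-+ m (toℕ i + toℕ g * toℕ j) (toℕ i′ + toℕ g * toℕ j′) _ _ (coord≡⇒%≡ g eq-g)
        (trans (cong (_% m) (sym (split i j)))
          (trans (coord≡⇒%≡ h eq-h) (cong (_% m) (split i′ j′)))))))
    conclude : j ≡ j′ → (i , j) ≡ (i′ , j′)
    conclude refl = cong (_, j) (coord-hub-injective g eq-g)

  _On_ : Point → Index → Set
  inj₁ k       On (i , j) = k ≡ j
  inj₂ (g , c) On b       = c ≡ coord g b

  -- A block has one hub and one point in each group, so two distinct points on it are a hub and a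
  -- group point, or points of different groups. Either pair determines the index.
  on-injective : ∀ x y {b b′} → x ≢ y → x On b → y On b → x On b′ → y On b′ → b ≡ b′
  on-injective (inj₁ k) (inj₁ l) x≢y refl refl _ _ = contradiction refl x≢y
  on-injective (inj₁ k) (inj₂ (g , c)) _ refl c≡ refl c≡′ =
    cong (_, k) (coord-hub-injective g (trans (sym c≡) c≡′))
  on-injective (inj₂ (g , c)) (inj₁ k) _ c≡ refl c≡′ refl =
    cong (_, k) (coord-hub-injective g (trans (sym c≡) c≡′))
  on-injective (inj₂ (g , c)) (inj₂ (h , d)) x≢y c≡ d≡ c≡′ d≡′ with Fin.<-cmp g h
  ... | tri< g<h _ _ = coord-coord-injective g<h (trans (sym c≡) c≡′) (trans (sym d≡) d≡′)
  ... | tri≈ _ refl _ = contradiction (cong (inj₂ ∘ (g ,_)) (trans c≡ (sym d≡))) x≢y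
  ... | tri> _ _ h<g = coord-coord-injective h<g (trans (sym d≡) d≡′) (trans (sym c≡) c≡′)

  transversal : Index → Fin 3 → Point
  transversal b g = inj₂ (g , coord g b)

  points : Index → List Point
  points b = inj₁ (proj₂ b) ∷ tabulate (transversal b)

  On⇒∈points : ∀ x {b} → x On b → x ∈ˡ points b
  On⇒∈points (inj₁ k)       refl = here refl
  On⇒∈points (inj₂ (g , c)) refl = there (∈-tabulate⁺ {f = transversal _} g)

  ∈points⇒On : ∀ {x b} → x ∈ˡ points b → x On b
  ∈points⇒On (here refl) = refl
  ∈points⇒On {b = b} (there x∈) with g , refl ← ∈-tabulate⁻ {f = transversal b} x∈ = refl

  points-unique : ∀ b → Unique (points b)
  points-unique b = 
    All.tabulate⁺ {f = transversal b} (λ _ ()) ∷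
    Unique.tabulate⁺ {f = transversal b} (cong proj₁ ∘ inj₂-injective)

  block : Index → Subset v
  block b = fromList (map encode (points b))

  On⇒∈block : ∀ x {b} → x On b → encode x ∈ block b
  On⇒∈block x x-on-b = ∈-fromList⁺ (∈-map⁺ encode (On⇒∈points x x-on-b))

  ∈block⇒On : ∀ {p b} → p ∈ block b → ∃[ x ] p ≡ encode x × x On b
  ∈block⇒On {p} {b} p∈ with x , x∈ , p≡ ← ∈-map⁻ encode (∈-fromList⁻ (map encode (points b)) p∈) =
    x , p≡ , ∈points⇒On x∈

  hubs : Subset v
  hubs = fromList (map (encode ∘ inj₁) (allFin 4))

  ∈hubs : ∀ k → encode (inj₁ k) ∈ hubs
  ∈hubs k = ∈-fromList⁺ (∈-map⁺ (encode ∘ inj₁) (∈-allFin k))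

  ∈hubs⁻ : ∀ {p} → p ∈ hubs → ∃[ k ] p ≡ encode (inj₁ k)
  ∈hubs⁻ p∈ with k , _ , p≡ ← ∈-map⁻ (encode ∘ inj₁) (∈-fromList⁻ (map (encode ∘ inj₁) (allFin 4)) p∈) =
    k , p≡

  ∣hubs∣≡4 : ∣ hubs ∣ ≡ 4
  ∣hubs∣≡4 = ∣fromList∣ (Unique.map⁺ (inj₁-injective ∘ encode-injective (inj₁ _) (inj₁ _)) (Unique.allFin⁺ 4))

  ∣block∣≡4 : ∀ b → ∣ block b ∣ ≡ 4
  ∣block∣≡4 b = ∣fromList∣ (Unique.map⁺ (encode-injective _ _) (points-unique b))

  hub∈block : ∀ {k b} → encode (inj₁ k) ∈ block b → k ≡ proj₂ b
  hub∈block {k} k∈ with x , k≡x , x-on-b ← ∈block⇒On k∈ with refl ← encode-injective (inj₁ k) x k≡x = x-on-b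

  hubs∩block : ∀ {b p q} → p ∈ hubs → q ∈ hubs → p ∈ block b → q ∈ block b → p ≡ q
  hubs∩block p∈hubs q∈hubs p∈ q∈ with _ , refl ← ∈hubs⁻ p∈hubs | _ , refl ← ∈hubs⁻ q∈hubs =
    cong (encode ∘ inj₁) (trans (hub∈block p∈) (sym (hub∈block q∈)))

  block∩block : ∀ {p q} → p ≢ q → ∀ {b b′} → p ∈ block b → q ∈ block b →
                p ∈ block b′ → q ∈ block b′ → b ≡ b′
  block∩block p≢q p∈b q∈b p∈b′ q∈b′
    with x , refl , x-on-b ← ∈block⇒On p∈b | y , refl , y-on-b ← ∈block⇒On q∈b
    with x′ , x≡x′ , x-on-b′ ← ∈block⇒On p∈b′ | y′ , y≡y′ , y-on-b′ ← ∈block⇒On q∈b′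
    with refl ← encode-injective x x′ x≡x′ | refl ← encode-injective y y′ y≡y′ =
    on-injective x y (p≢q ∘ cong encode) x-on-b y-on-b x-on-b′ y-on-b′

  -- Every block has two distinct points, its hub and its point of group 0, so equal blocks share a
  -- pair and `block∩block` applies.
  block-injective : ∀ {b b′} → block b ≡ block b′ → b ≡ b′
  block-injective {b} {b′} eq = block∩block
    (λ p≡q → contradiction (encode-injective (inj₁ (proj₂ b)) (transversal b zero) p≡q) λ ())
    hub∈ zero∈ (subst (_ ∈_) eq hub∈) (subst (_ ∈_) eq zero∈)
    where
    hub∈ : encode (inj₁ (proj₂ b)) ∈ block b
    hub∈ = On⇒∈block (inj₁ (proj₂ b)) refl
    zero∈ : encode (transversal b zero) ∈ block b
    zero∈ = On⇒∈block (transversal b zero) refl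

  hubs≢block : ∀ b → hubs ≢ block b
  hubs≢block b eq with encode-injective (inj₁ zero) (inj₁ (suc zero))
    (hubs∩block {b = b} (∈hubs zero) (∈hubs (suc zero))
      (subst (_ ∈_) eq (∈hubs zero)) (subst (_ ∈_) eq (∈hubs (suc zero))))
  ... | ()

  block-at : Fin (m * 4) → Subset v
  block-at = block ∘ remQuot 4

  allBlocks : List (Subset v)
  allBlocks = hubs ∷ tabulate block-at

  block∈ : ∀ b → block b ∈ˡ allBlocks
  block∈ (i , j) = there (subst (λ b → block b ∈ˡ tabulate block-at) (Fin.remQuot-combine i j)
                           (∈-tabulate⁺ (combine i j)))

  ∈allBlocks : ∀ {B} → B ∈ˡ allBlocks → B ≡ hubs ⊎ ∃[ b ] B ≡ block b
  ∈allBlocks (here refl) = inj₁ refl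
  ∈allBlocks (there B∈) with t , refl ← ∈-tabulate⁻ B∈ = inj₂ (remQuot 4 t , refl)

  design : Packing v 4
  design = record
    { 2≤k           = s≤s (s≤s z≤n)
    ; k≤v           = ≤-trans (m≤m+n 4 _) fits
    ; blocks        = allBlocks
    ; blocks-unique = All.tabulate⁺ (hubs≢block ∘ remQuot 4) ∷
        Unique.tabulate⁺ λ {s} {t} eq → trans (sym (Fin.combine-remQuot {m} 4 s))
          (trans (cong (λ (i , j) → combine i j) (block-injective eq)) (Fin.combine-remQuot {m} 4 t))
    ; blocks-size   = ∣hubs∣≡4 ∷ All.tabulate⁺ (∣block∣≡4 ∘ remQuot 4)
    ; pair-in-≤1    = λ p≢q B∈ C∈ → linear p≢q (∈allBlocks B∈) (∈allBlocks C∈)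
    }
    where
    linear : ∀ {p q} → p ≢ q → ∀ {B C} → B ≡ hubs ⊎ ∃[ b ] B ≡ block b → C ≡ hubs ⊎ ∃[ c ] C ≡ block c →
             p ∈ B → q ∈ B → p ∈ C → q ∈ C → B ≡ C
    linear p≢q (inj₁ refl)       (inj₁ refl)       p∈B q∈B p∈C q∈C = refl
    linear p≢q (inj₁ refl)       (inj₂ (b , refl)) p∈B q∈B p∈C q∈C =
      contradiction (hubs∩block p∈B q∈B p∈C q∈C) p≢q
    linear p≢q (inj₂ (b , refl)) (inj₁ refl)       p∈B q∈B p∈C q∈C =
      contradiction (hubs∩block p∈C q∈C p∈B q∈B) p≢q
    linear p≢q (inj₂ (b , refl)) (inj₂ (c , refl)) p∈B q∈B p∈C q∈C =
      cong block (block∩block p≢q p∈B q∈B p∈C q∈C)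

  numBlocks-design : numBlocks design ≡ suc (m * 4)
  numBlocks-design = cong suc (length-tabulate block-at)

  meets-hubs : ∀ {B} → B ∈ˡ allBlocks → Nonempty (B ∩ hubs)
  meets-hubs B∈ with ∈allBlocks B∈
  ... | inj₁ refl       = _ , x∈p∩q⁺ (∈hubs zero , ∈hubs zero)
  ... | inj₂ (b , refl) = _ , x∈p∩q⁺ (On⇒∈block (inj₁ (proj₂ b)) refl , ∈hubs (proj₂ b))

  -- (j , j) has coordinates (1 + g) j < 10 ≤ m, which are distinct for distinct j.
  diagonal : Fin 4 → Index
  diagonal j = inject≤ j (≤-trans (m≤m+n 4 6) 10≤m) , j

  diagonal-disjoint : ∀ {j k} → j ≢ k → Disjoint (block (diagonal j)) (block (diagonal k))
  diagonal-disjoint {j} {k} j≢k (p , p∈)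
    with x , refl , x-on-j ← ∈block⇒On (proj₁ (x∈p∩q⁻ (block (diagonal j)) (block (diagonal k)) p∈))
    with y , x≡y , y-on-k ← ∈block⇒On (proj₂ (x∈p∩q⁻ (block (diagonal j)) (block (diagonal k)) p∈))
    with refl ← encode-injective x y x≡y = contradiction (meet x x-on-j y-on-k) j≢k
    where
    value : ∀ (g : Fin 3) (j : Fin 4) → toℕ (proj₁ (diagonal j)) + toℕ g * toℕ j ≡ suc (toℕ g) * toℕ j
    value g j = cong (_+ toℕ g * toℕ j) (Fin.toℕ-inject≤ j _)
    value<m : ∀ (g : Fin 3) (j : Fin 4) → suc (toℕ g) * toℕ j < m
    value<m g j = ≤-trans (s≤s (*-mono-≤ (Fin.toℕ<n g) (s≤s⁻¹ (Fin.toℕ<n j)))) 10≤m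
    meet : ∀ x {j k} → x On diagonal j → x On diagonal k → j ≡ k
    meet (inj₁ _) refl refl = refl
    meet (inj₂ (g , c)) {j} {k} c≡ c≡′ = Fin.toℕ-injective (*-cancelˡ-≡ (toℕ j) (toℕ k) (suc (toℕ g))
      (%-injective m (value<m g j) (value<m g k)
        (trans (cong (_% m) (sym (value g j)))
          (trans (coord≡⇒%≡ g (trans (sym c≡) c≡′)) (cong (_% m) (value g k))))))

  design-maximumPPC : MaximumPPCSize design 4
  design-maximumPPC = (tabulate (block ∘ diagonal) , ppc , refl) , no-5
    where
    disj : AllPairs Disjoint (tabulate (block ∘ diagonal))
    disj = AllPairs.tabulate⁺ diagonal-disjoint
    ppc : IsPPC design (tabulate (block ∘ diagonal))
    ppc = record
      { ⊆-blocks = λ B∈ → let j , B≡ = ∈-tabulate⁻ {f = block ∘ diagonal} B∈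
                          in subst (_∈ˡ allBlocks) (sym B≡) (block∈ (diagonal j))
      ; unique = Unique.tabulate⁺ {f = block ∘ diagonal} (cong proj₂ ∘ block-injective)
      ; pairwise-disjoint = disj }
    no-5 : ¬ HasPPCOfSize design 5
    no-5 (P , isPPC , ∣P∣≡5) = contradiction (begin
      5              ≡⟨ ∣P∣≡5 ⟨
      -- Every member of `P` contains a hub, and by disjointness no hub lies in two members.
      length P       ≤⟨ length-hitting 1 hubs P (All.tabulate (meets-hubs ∘ ⊆-blocks)) (λ {x} _ → deg x) ⟩
      ∣ hubs ∣ * 1   ≡⟨ *-identityʳ _ ⟩
      ∣ hubs ∣       ≡⟨ ∣hubs∣≡4 ⟩
      4              ∎) (<⇒≱ (s≤s ≤-refl))
      where
      open ≤-Reasoning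
      open IsPPC isPPC
      common⇒≡ : ∀ {x P} → AllPairs Disjoint P → ∀ {B C} → B ∈ˡ P → C ∈ˡ P → x ∈ B → x ∈ C → B ≡ C
      common⇒≡ (_ ∷ _)   (here refl) (here refl) _   _   = refl
      common⇒≡ (B∥ ∷ _)  (here refl) (there C∈)  x∈B x∈C = contradiction (-, x∈p∩q⁺ (x∈B , x∈C)) (All.lookup B∥ C∈)
      common⇒≡ (C∥ ∷ _)  (there B∈)  (here refl) x∈B x∈C = contradiction (-, x∈p∩q⁺ (x∈C , x∈B)) (All.lookup C∥ B∈)
      common⇒≡ (_ ∷ ds)  (there B∈)  (there C∈)  x∈B x∈C = common⇒≡ ds B∈ C∈ x∈B x∈C
      deg : ∀ x → length (filter (x ∈?_) P) ≤ 1
      deg x = length≤1 (Unique.filter⁺ (x ∈?_) unique) λ B∈ C∈ →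
        let B∈P , x∈B = ∈-filter⁻ (x ∈?_) {xs = P} B∈
            C∈P , x∈C = ∈-filter⁻ (x ∈?_) {xs = P} C∈
        in common⇒≡ pairwise-disjoint B∈P C∈P x∈B x∈C

-- Existence of the maximum by exhaustive search.

-- Fixing the length makes the search finite: choose the head by `any?` and recurse on the tail.
-- Here `A` will be `Subset v`, for lists of blocks as well as for partial parallel classes.
anyList? : ∀ {a} {A : Set a} → (∀ {P : Pred A a} → Decidable P → Dec (∃[ x ] P x)) →
           ∀ n {P : Pred (List A) a} → Decidable P → Dec (∃[ xs ] length xs ≡ n × P xs)
anyList? any? zero P? =
  map′ (λ p → [] , refl , p) (λ { ([] , _ , p) → p }) (P? [])
anyList? any? (suc n) P? = map′
  (λ { (x , xs , len , p) → x ∷ xs , cong suc len , p })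
  (λ { (x ∷ xs , len , p) → x , xs , suc-injective len , p })
  (any? λ x → anyList? any? n λ xs → P? (x ∷ xs))

_≟ˢ_ : DecidableEquality (Subset v)
_≟ˢ_ = ≡-decᵛ _≟ᵇ_

-- The conditions of `Packing` on a bare list, with all quantifiers ranging over `Fin v` or over the
-- list so that each can be decided.
IsPacking : ℕ → List (Subset v) → Set
IsPacking {v} k 𝓑 = Unique 𝓑 × All (λ B → ∣ B ∣ ≡ k) 𝓑 ×
  (∀ (x y : Fin v) → x ≢ y →
    All (λ B → All (λ C → x ∈ B → y ∈ B → x ∈ C → y ∈ C → B ≡ C) 𝓑) 𝓑)

isPacking? : ∀ k → Decidable (IsPacking {v} k)
isPacking? k 𝓑 =
  allPairs? (λ B C → ¬? (B ≟ˢ C)) 𝓑 ×-dec All.all? (λ B → ∣ B ∣ ≟ k) 𝓑 ×-dec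
  Fin.all? λ x → Fin.all? λ y → ¬? (x Fin.≟ y) →-dec
    All.all? (λ B → All.all? (λ C →
      x ∈? B →-dec (y ∈? B →-dec (x ∈? C →-dec (y ∈? C →-dec B ≟ˢ C)))) 𝓑) 𝓑

packing : ∀ {k} → 2 ≤ k → k ≤ v → {𝓑 : List (Subset v)} → IsPacking k 𝓑 → Packing v k
packing 2≤k k≤v {𝓑} (uniq , size , lin) = record
  { 2≤k = 2≤k ; k≤v = k≤v ; blocks = 𝓑 ; blocks-unique = uniq ; blocks-size = size
  ; pair-in-≤1 = λ {x} {y} x≢y B∈ C∈ → All.lookup (All.lookup (lin x y x≢y) B∈) C∈ }

isPacking : ∀ {k} (D : Packing v k) → IsPacking k (blocks D)
isPacking D = blocks-unique D , blocks-size D ,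
  λ x y x≢y → All.tabulate λ B∈ → All.tabulate λ C∈ → pair-in-≤1 D x≢y B∈ C∈

hasPPCOfSize? : ∀ {k} (D : Packing v k) → Decidable (HasPPCOfSize D)
hasPPCOfSize? D ρ = map′
  (λ { (P , len , P⊆ , uniq , disj) → P , record
       { ⊆-blocks = All.lookup P⊆ ; unique = uniq ; pairwise-disjoint = disj } , len })
  (λ { (P , isPPC , len) → let open IsPPC isPPC in
       P , len , All.tabulate ⊆-blocks , unique , pairwise-disjoint })
  (anyList? anySubset? ρ λ P →
    All.all? (_∈ˡ? blocks D) P ×-dec allPairs? (λ B C → ¬? (B ≟ˢ C)) P ×-dec
    allPairs? (λ B C → ¬? (nonempty? (B ∩ C))) P)
  where open DecMembership _≟ˢ_ using () renaming (_∈?_ to _∈ˡ?_)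

-- Packings with the same blocks may carry different proofs of the axioms. This moves the property
-- between a given packing and the one rebuilt from its list of blocks.
maximumPPCSize-resp-blocks : ∀ {k ρ} {D E : Packing v k} → blocks D ≡ blocks E →
                             MaximumPPCSize D ρ → MaximumPPCSize E ρ
maximumPPCSize-resp-blocks D≡E (has , ¬has) = transfer D≡E has , ¬has ∘ transfer (sym D≡E)
  where
  transfer : ∀ {k ρ} {D E : Packing v k} → blocks D ≡ blocks E → HasPPCOfSize D ρ → HasPPCOfSize E ρ
  transfer D≡E (P , isPPC , len) = let open IsPPC isPPC in
    P , record { ⊆-blocks = λ B∈ → subst (_ ∈ˡ_) D≡E (⊆-blocks B∈) ; unique = unique
               ; pairwise-disjoint = pairwise-disjoint } , len

attained? : ∀ {ρ v k} → 2 ≤ k → k ≤ v →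
            Decidable λ b → ∃[ D ] MaximumPPCSize {v} {k} D ρ × numBlocks D ≡ b
attained? {ρ} {v} {k} 2≤k k≤v b = map′
  (λ { (𝓑 , len , p , max) → packing 2≤k k≤v p , max , len })
  (λ { (D , max , len) → blocks D , len , isPacking D , maximumPPCSize-resp-blocks refl max })
  (anyList? anySubset? b witness?)
  where
  witness? : Decidable λ 𝓑 → ∃[ p ] MaximumPPCSize (packing 2≤k k≤v {𝓑} p) ρ
  witness? 𝓑 with isPacking? k 𝓑
  ... | no ¬p = no (¬p ∘ proj₁)
  ... | yes p = map′ (p ,_) (λ (_ , max) → maximumPPCSize-resp-blocks refl max)
    (hasPPCOfSize? (packing 2≤k k≤v p) ρ ×-dec ¬? (hasPPCOfSize? (packing 2≤k k≤v p) (suc ρ)))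

-- Descend from `u`, lowering the bound at each failure; `P l` ensures that the descent succeeds at
-- 0 at the latest.
greatest : ∀ {p} {P : Pred ℕ p} → Decidable P → ∀ u {l} → P l → (∀ {n} → P n → n ≤ u) →
           ∃[ b ] P b × (∀ {n} → P n → n ≤ b)
greatest P? u {l} Pl ≤u with P? u
... | yes Pu = u , Pu , ≤u
greatest {P = P} P? zero {l} Pl ≤u | no ¬P0 = contradiction (subst P (n≤0⇒n≡0 (≤u Pl)) Pl) ¬P0
greatest P? (suc u) Pl ≤u | no ¬Pu =
  greatest P? u Pl λ Pn → s≤s⁻¹ (≤∧≢⇒< (≤u Pn) λ { refl → ¬Pu Pn })

-- Floors and residues modulo 3.

-- Since 4v = 3(1 + 4q) + 13 + 4r, the division is exact. For r = 0, 1, 2 the number 13 + 4r is 13,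
-- 17, 21, the three constants of the lower bound.
4v∸[13+4r]/3 : ∀ q r {v} → v ≡ 4 + (r + q * 3) → (4 * v ∸ (13 + 4 * r)) / 3 ≡ suc (q * 4)
4v∸[13+4r]/3 q r {v} v≡ = begin
  (4 * v ∸ (13 + 4 * r)) / 3                            ≡⟨ cong (λ x → (4 * x ∸ (13 + 4 * r)) / 3) v≡ ⟩
  (4 * (4 + (r + q * 3)) ∸ (13 + 4 * r)) / 3            ≡⟨ cong (λ x → (x ∸ (13 + 4 * r)) / 3) (expand q r) ⟩
  (suc (q * 4) * 3 + (13 + 4 * r) ∸ (13 + 4 * r)) / 3   ≡⟨ cong (_/ 3) (m+n∸n≡m (suc (q * 4) * 3) (13 + 4 * r)) ⟩
  suc (q * 4) * 3 / 3                                   ≡⟨ m*n/n≡m (suc (q * 4)) 3 ⟩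
  suc (q * 4)                                           ∎
  where
  open ≡-Reasoning
  expand : ∀ q r → 4 * (4 + (r + q * 3)) ≡ suc (q * 4) * 3 + (13 + 4 * r)
  expand = solve-∀

LowerBounds : ℕ → ℕ → Set
LowerBounds v b = (v % 3 ≡ 0 → b ≥ (4 * v ∸ 21) / 3)
                × (v % 3 ≡ 1 → b ≥ (4 * v ∸ 13) / 3)
                × (v % 3 ≡ 2 → b ≥ (4 * v ∸ 17) / 3)

lowerBounds : ∀ q (r : Fin 3) {v b} → v ≡ 4 + (toℕ r + q * 3) → suc (q * 4) ≤ b → LowerBounds v b
lowerBounds q r {v} {b} v≡ ≤b = by-residue r v≡ (trans (cong (_% 3) v≡) (v%3 r))
  where
  v%3 : ∀ (r : Fin 3) → (4 + (toℕ r + q * 3)) % 3 ≡ (4 + toℕ r) % 3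
  v%3 r = [m+kn]%n≡m%n (4 + toℕ r) q 3
  ok : ∀ r → v ≡ 4 + (r + q * 3) → b ≥ (4 * v ∸ (13 + 4 * r)) / 3
  ok r v≡ = ≤-trans (≤-reflexive (4v∸[13+4r]/3 q r v≡)) ≤b
  absurd : ∀ {x y z} {A : Set} → y ≢ z → x ≡ y → x ≡ z → A
  absurd y≢z x≡y x≡z = contradiction (trans (sym x≡y) x≡z) y≢z
  by-residue : ∀ (r : Fin 3) → v ≡ 4 + (toℕ r + q * 3) → v % 3 ≡ (4 + toℕ r) % 3 → LowerBounds v b
  -- As v ≡ 4 + r modulo 3, the values r = 0, 1, 2 belong to v ≡ 1, 2, 0.
  by-residue zero             v≡ res = absurd (λ ()) res , (λ _ → ok 0 v≡) , absurd (λ ()) res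
  by-residue (suc zero)       v≡ res = absurd (λ ()) res , absurd (λ ()) res , λ _ → ok 1 v≡
  by-residue (suc (suc zero)) v≡ res = (λ _ → ok 2 v≡) , absurd (λ ()) res , absurd (λ ()) res

theorem4p4 : ∀ (v : ℕ) → v ≥ 240 →
    ∃[ b ] (β⟨ 4 , v , 4 ⟩≡ b)
    × (b ≤ (4 * v ∸ 10) / 3)
    × (v % 3 ≡ 0 → b ≥ (4 * v ∸ 21) / 3)
    × (v % 3 ≡ 1 → b ≥ (4 * v ∸ 13) / 3)
    × (v % 3 ≡ 2 → b ≥ (4 * v ∸ 17) / 3)
theorem4p4 v v≥240 with (v ∸ 4) divMod 3
... | result q r v∸4≡ =
  -- The upper bound is the start of the descent, and the design shows that some value is attained.
  let b , attained , ≤b = greatest (attained? (s≤s (s≤s z≤n)) 4≤v) ((4 * v ∸ 10) / 3)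
                            (design , design-maximumPPC , refl) upper
  in b , record { attained = attained ; maximal = λ D max → ≤b (D , max , refl) } , upper attained ,
     lowerBounds q r v≡ (subst (_≤ b) numBlocks-design (≤b (design , design-maximumPPC , refl)))
  where
  4≤v : 4 ≤ v
  4≤v = ≤-trans (m≤m+n 4 236) v≥240
  v≡ : v ≡ 4 + (toℕ r + q * 3)
  v≡ = trans (sym (m+[n∸m]≡n 4≤v)) (cong (4 +_) v∸4≡)
  10≤q : 10 ≤ q
  -- Since r ≤ 2, `v` is at most 6 + 3q, while it is at least 36 = 6 + 10 · 3.
  10≤q = *-cancelʳ-≤ 10 q 3 (+-cancelˡ-≤ 6 30 (q * 3) (begin
    36                   ≤⟨ m≤m+n 36 204 ⟩
    240                  ≤⟨ v≥240 ⟩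
    v                    ≡⟨ v≡ ⟩
    4 + (toℕ r + q * 3)  ≤⟨ +-monoʳ-≤ 4 (+-monoˡ-≤ (q * 3) (s≤s⁻¹ (Fin.toℕ<n r))) ⟩
    6 + q * 3            ∎))
    where open ≤-Reasoning
  fits : 4 + 3 * q ≤ v
  fits = begin
    4 + 3 * q            ≡⟨ cong (4 +_) (*-comm 3 q) ⟩
    4 + q * 3            ≤⟨ +-monoʳ-≤ 4 (m≤n+m (q * 3) (toℕ r)) ⟩
    4 + (toℕ r + q * 3)  ≡⟨ v≡ ⟨
    v                    ∎
    where open ≤-Reasoning
  open Construction q v 10≤q fits
  upper : ∀ {n} → ∃[ D ] MaximumPPCSize {v} {4} D 4 × numBlocks D ≡ n → n ≤ (4 * v ∸ 10) / 3
  upper (D , max , refl) = numBlocks-upper v≥240 D max
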